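{- $\text{\ss}_o \leq \mathbf{non}(\mathcal{M})$, where $\text{\ss}_o$ is the subseries number for divergence by oscillation and $\mathbf{non}(\mathcal{M})$ is the uniformity of Baire category.
   Context: $\mathbb{N}=\{1,2,3,\dots\}$. For $A\subseteq\mathbb{N}$, the subseries $\sum_{n\in A}a_n$ is summed in increasing order of the indices. A series is conditionally convergent if it converges but not absolutely. A series diverges by oscillation if its partial sums neither converge to a real number nor tend to $+\infty$ nor tend to $-\infty$. $\text{\ss}_o$ is the smallest cardinality of a family $\mathcal{A}$ of subsets of $\mathbb{N}$ such that for every conditionally convergent series $\sum_{n\in\mathbb{N}}a_n$ of real numbers there is $A\in\mathcal{A}$ such that $\sum_{n\in A}a_n$ diverges by oscillation. $\mathbf{non}(\mathcal{M})$ is the minimum cardinality of a non-meager subset of the Cantor space $2^{\mathbb{N}}$. -}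

module Defs where

open import Data.Bool.Base using (Bool; if_then_else_)
open import Data.Nat.Base as ℕ using (ℕ; zero; suc)
import Data.Nat.Properties as ℕ
open import Data.Product.Base using (∃; ∃-syntax; Σ-syntax; _×_; _,_; proj₁; proj₂)
open import Data.Rational.Base as ℚ using (ℚ; 0ℚ; ½)
import Data.Rational.Properties as ℚ
open import Data.Rational.Solver using (module +-*-Solver)
open import Data.Sum.Base using ([_,_]′)
open import Function.Bundles using (Injection; Inverse)
open import Level using (Level; 0ℓ; _⊔_) renaming (suc to lsuc)
open import Relation.Binary.Bundles using (Setoid)
import Relation.Binary.Construct.On as On
open import Relation.Binary.PropositionalEquality
  using (_≡_; refl; sym; cong; subst; module ≡-Reasoning; _→-setoid_)
open import Relation.Nullary.Negation using (¬_)
open import Relation.Unary using (Pred; _∈_; _⊆_; Empty; ⋃)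

------------------------------------------------------------------------
-- Real numbers: Cauchy sequences of rationals.  Two sequences may
-- represent the same real; every notion below is invariant under this.

IsCauchy : (ℕ → ℚ) → Set
IsCauchy x = ∀ ε → 0ℚ ℚ.< ε →
  ∃[ N ] (∀ m n → N ℕ.≤ m → N ℕ.≤ n → ℚ.∣ x m ℚ.- x n ∣ ℚ.≤ ε)

record ℝ : Set where
  constructor mkℝ
  field
    approx   : ℕ → ℚ
    isCauchy : IsCauchy approx

open ℝ public

private
  half-pos : ∀ {ε} → 0ℚ ℚ.< ε → 0ℚ ℚ.< ½ ℚ.* ε
  half-pos {ε} 0<ε =
    subst (ℚ._< ½ ℚ.* ε) (ℚ.*-zeroʳ ½) (ℚ.*-monoʳ-<-pos ½ 0<ε)

  halves : ∀ ε → ½ ℚ.* ε ℚ.+ ½ ℚ.* ε ≡ ε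
  halves ε = begin
    ½ ℚ.* ε ℚ.+ ½ ℚ.* ε ≡⟨ ℚ.*-distribʳ-+ ε ½ ½ ⟨
    (½ ℚ.+ ½) ℚ.* ε     ≡⟨⟩
    ℚ.1ℚ ℚ.* ε          ≡⟨ ℚ.*-identityˡ ε ⟩
    ε                   ∎
    where open ≡-Reasoning

  interchange : ∀ p q r s → (p ℚ.+ q) ℚ.- (r ℚ.+ s) ≡ (p ℚ.- r) ℚ.+ (q ℚ.- s)
  interchange = solve 4
    (λ p q r s → (p :+ q) :- (r :+ s) := (p :- r) :+ (q :- s)) refl
    where open +-*-Solver

  neg-swap : ∀ p q → (ℚ.- p) ℚ.- (ℚ.- q) ≡ ℚ.- (p ℚ.- q)
  neg-swap = solve 2 (λ p q → (:- p) :- (:- q) := :- (p :- q)) refl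
    where open +-*-Solver

  cancel : ∀ p q → (p ℚ.- q) ℚ.+ q ≡ p
  cancel = solve 2 (λ p q → (p :- q) :+ q := p) refl
    where open +-*-Solver

  cancel′ : ∀ p q → (p ℚ.+ q) ℚ.- q ≡ p
  cancel′ = solve 2 (λ p q → (p :+ q) :- q := p) refl
    where open +-*-Solver

  flip-neg : ∀ p q → ℚ.- (p ℚ.- q) ≡ q ℚ.- p
  flip-neg = solve 2 (λ p q → :- (p :- q) := q :- p) refl
    where open +-*-Solver

  ∣p∣-∣q∣≤∣p-q∣ : ∀ p q → ℚ.∣ p ∣ ℚ.- ℚ.∣ q ∣ ℚ.≤ ℚ.∣ p ℚ.- q ∣
  ∣p∣-∣q∣≤∣p-q∣ p q = begin
    ℚ.∣ p ∣ ℚ.- ℚ.∣ q ∣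
      ≡⟨ cong (λ t → ℚ.∣ t ∣ ℚ.- ℚ.∣ q ∣) (cancel p q) ⟨
    ℚ.∣ (p ℚ.- q) ℚ.+ q ∣ ℚ.- ℚ.∣ q ∣
      ≤⟨ ℚ.+-monoˡ-≤ (ℚ.- ℚ.∣ q ∣) (ℚ.∣p+q∣≤∣p∣+∣q∣ (p ℚ.- q) q) ⟩
    (ℚ.∣ p ℚ.- q ∣ ℚ.+ ℚ.∣ q ∣) ℚ.- ℚ.∣ q ∣
      ≡⟨ cancel′ ℚ.∣ p ℚ.- q ∣ ℚ.∣ q ∣ ⟩
    ℚ.∣ p ℚ.- q ∣ ∎
    where open ℚ.≤-Reasoning

  ∣-∣-sym : ∀ p q → ℚ.∣ p ℚ.- q ∣ ≡ ℚ.∣ q ℚ.- p ∣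
  ∣-∣-sym p q = begin
    ℚ.∣ p ℚ.- q ∣       ≡⟨ cong ℚ.∣_∣ (flip-neg q p) ⟨
    ℚ.∣ ℚ.- (q ℚ.- p) ∣ ≡⟨ ℚ.∣-p∣≡∣p∣ (q ℚ.- p) ⟩
    ℚ.∣ q ℚ.- p ∣       ∎
    where open ≡-Reasoning

  ∣∣p∣-∣q∣∣≤∣p-q∣ : ∀ p q → ℚ.∣ ℚ.∣ p ∣ ℚ.- ℚ.∣ q ∣ ∣ ℚ.≤ ℚ.∣ p ℚ.- q ∣
  ∣∣p∣-∣q∣∣≤∣p-q∣ p q = [ nonneg , neg ]′ (ℚ.∣p∣≡p∨∣p∣≡-p d)
    where
    open ℚ.≤-Reasoning
    d = ℚ.∣ p ∣ ℚ.- ℚ.∣ q ∣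

    nonneg : ℚ.∣ d ∣ ≡ d → ℚ.∣ d ∣ ℚ.≤ ℚ.∣ p ℚ.- q ∣
    nonneg eq = begin
      ℚ.∣ d ∣       ≡⟨ eq ⟩
      d             ≤⟨ ∣p∣-∣q∣≤∣p-q∣ p q ⟩
      ℚ.∣ p ℚ.- q ∣ ∎

    neg : ℚ.∣ d ∣ ≡ ℚ.- d → ℚ.∣ d ∣ ℚ.≤ ℚ.∣ p ℚ.- q ∣
    neg eq = begin
      ℚ.∣ d ∣             ≡⟨ eq ⟩
      ℚ.- d               ≡⟨ flip-neg ℚ.∣ p ∣ ℚ.∣ q ∣ ⟩
      ℚ.∣ q ∣ ℚ.- ℚ.∣ p ∣ ≤⟨ ∣p∣-∣q∣≤∣p-q∣ q p ⟩
      ℚ.∣ q ℚ.- p ∣       ≡⟨ ∣-∣-sym q p ⟩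
      ℚ.∣ p ℚ.- q ∣       ∎

fromℚ : ℚ → ℝ
fromℚ q = mkℝ (λ _ → q) λ ε 0<ε → 0 , λ _ _ _ _ →
  subst (ℚ._≤ ε) (sym (cong ℚ.∣_∣ (ℚ.+-inverseʳ q))) (ℚ.<⇒≤ 0<ε)

0ℝ : ℝ
0ℝ = fromℚ 0ℚ

infixl 6 _+_ _-_
infix  8 -_
infix  4 _<_

_+_ : ℝ → ℝ → ℝ
mkℝ x cx + mkℝ y cy = mkℝ (λ n → x n ℚ.+ y n) λ ε 0<ε →
  let M , hx = cx (½ ℚ.* ε) (half-pos 0<ε)
      N , hy = cy (½ ℚ.* ε) (half-pos 0<ε)
  in M ℕ.⊔ N , λ m n m≥ n≥ → let open ℚ.≤-Reasoning in begin
    ℚ.∣ (x m ℚ.+ y m) ℚ.- (x n ℚ.+ y n) ∣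
      ≡⟨ cong ℚ.∣_∣ (interchange (x m) (y m) (x n) (y n)) ⟩
    ℚ.∣ (x m ℚ.- x n) ℚ.+ (y m ℚ.- y n) ∣
      ≤⟨ ℚ.∣p+q∣≤∣p∣+∣q∣ (x m ℚ.- x n) (y m ℚ.- y n) ⟩
    ℚ.∣ x m ℚ.- x n ∣ ℚ.+ ℚ.∣ y m ℚ.- y n ∣
      ≤⟨ ℚ.+-mono-≤
           (hx m n (ℕ.m⊔n≤o⇒m≤o M N m≥) (ℕ.m⊔n≤o⇒m≤o M N n≥))
           (hy m n (ℕ.m⊔n≤o⇒n≤o M N m≥) (ℕ.m⊔n≤o⇒n≤o M N n≥)) ⟩
    ½ ℚ.* ε ℚ.+ ½ ℚ.* ε
      ≡⟨ halves ε ⟩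
    ε ∎

-_ : ℝ → ℝ
- mkℝ x cx = mkℝ (λ n → ℚ.- x n) λ ε 0<ε →
  let N , h = cx ε 0<ε
  in N , λ m n m≥ n≥ → let open ℚ.≤-Reasoning in begin
    ℚ.∣ (ℚ.- x m) ℚ.- (ℚ.- x n) ∣ ≡⟨ cong ℚ.∣_∣ (neg-swap (x m) (x n)) ⟩
    ℚ.∣ ℚ.- (x m ℚ.- x n) ∣       ≡⟨ ℚ.∣-p∣≡∣p∣ (x m ℚ.- x n) ⟩
    ℚ.∣ x m ℚ.- x n ∣             ≤⟨ h m n m≥ n≥ ⟩
    ε ∎

_-_ : ℝ → ℝ → ℝ
x - y = x + (- y)

∣_∣ : ℝ → ℝ
∣ mkℝ x cx ∣ = mkℝ (λ n → ℚ.∣ x n ∣) λ ε 0<ε →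
  let N , h = cx ε 0<ε
  in N , λ m n m≥ n≥ →
    ℚ.≤-trans (∣∣p∣-∣q∣∣≤∣p-q∣ (x m) (x n)) (h m n m≥ n≥)

_<_ : ℝ → ℝ → Set
x < y = ∃[ ε ] 0ℚ ℚ.< ε ×
  ∃[ N ] (∀ n → N ℕ.≤ n → approx x n ℚ.+ ε ℚ.≤ approx y n)

------------------------------------------------------------------------
-- Limits of sequences of reals

_⟶_ : (ℕ → ℝ) → ℝ → Set
s ⟶ L = ∀ ε → 0ℝ < ε → ∃[ N ] (∀ n → N ℕ.≤ n → ∣ s n - L ∣ < ε)

Converges : (ℕ → ℝ) → Set
Converges s = ∃[ L ] s ⟶ L

_⟶+∞ : (ℕ → ℝ) → Set
s ⟶+∞ = ∀ B → ∃[ N ] (∀ n → N ℕ.≤ n → B < s n)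

_⟶-∞ : (ℕ → ℝ) → Set
s ⟶-∞ = ∀ B → ∃[ N ] (∀ n → N ℕ.≤ n → s n < B)

Oscillates : (ℕ → ℝ) → Set
Oscillates s = ¬ Converges s × ¬ (s ⟶+∞) × ¬ (s ⟶-∞)

------------------------------------------------------------------------
-- Series and subseries.  Indices start at 0; this only renames the
-- index set.

partialSum : (ℕ → ℝ) → ℕ → ℝ
partialSum a zero    = 0ℝ
partialSum a (suc n) = partialSum a n + a n

ConditionallyConvergent : (ℕ → ℝ) → Set
ConditionallyConvergent a =
  Converges (partialSum a) × ¬ Converges (partialSum (λ n → ∣ a n ∣))

-- The points of the Cantor space, and equally the subsets of ℕ (as
-- characteristic functions).
2^ℕ : Set
2^ℕ = ℕ → Bool

-- subsum A a n is the sum of the a i with i ∈ A and i < n, taken in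
-- increasing order of i.  Compared with the partial sums indexed by an
-- enumeration of A, values are only repeated, never added or dropped.
subsum : 2^ℕ → (ℕ → ℝ) → ℕ → ℝ
subsum A a zero    = 0ℝ
subsum A a (suc n) = if A n then subsum A a n + a n else subsum A a n

OscillationFamily : Pred (Pred 2^ℕ 0ℓ) 0ℓ
OscillationFamily 𝒜 =
  ∀ a → ConditionallyConvergent a → ∃[ A ] A ∈ 𝒜 × Oscillates (subsum A a)

------------------------------------------------------------------------
-- Baire category in the Cantor space.  The topology is the product
-- topology, with basic neighbourhoods { y ∣ x ≈[ n ] y } of x.

_≈[_]_ : 2^ℕ → ℕ → 2^ℕ → Set
x ≈[ n ] y = ∀ i → i ℕ.< n → x i ≡ y i

Closure : Pred 2^ℕ 0ℓ → Pred 2^ℕ 0ℓ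
Closure D x = ∀ n → ∃[ y ] x ≈[ n ] y × y ∈ D

Interior : Pred 2^ℕ 0ℓ → Pred 2^ℕ 0ℓ
Interior D x = ∃[ n ] (∀ y → x ≈[ n ] y → y ∈ D)

NowhereDense : Pred 2^ℕ 0ℓ → Set
NowhereDense D = Empty (Interior (Closure D))

Meager : Pred (Pred 2^ℕ 0ℓ) (lsuc 0ℓ)
Meager X = Σ[ D ∈ (ℕ → Pred 2^ℕ 0ℓ) ]
  (∀ k → NowhereDense (D k)) × X ⊆ ⋃ ℕ D

NonMeager : Pred (Pred 2^ℕ 0ℓ) (lsuc 0ℓ)
NonMeager X = ¬ Meager X

------------------------------------------------------------------------
-- Cardinalities, represented by setoids

-- A subset of 2^ℕ as a set in its own right, its elements being
-- identified when they are pointwise equal.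
⟪_⟫ : Pred 2^ℕ 0ℓ → Setoid 0ℓ 0ℓ
⟪ X ⟫ = On.setoid {B = ∃ X} (ℕ →-setoid Bool) proj₁

infix 4 _≲_

_≲_ : Setoid 0ℓ 0ℓ → Setoid 0ℓ 0ℓ → Set
κ ≲ μ = Injection κ μ

record IsLeastCardinality {ℓ : Level} (P : Pred (Pred 2^ℕ 0ℓ) ℓ)
                          (κ : Setoid 0ℓ 0ℓ) : Set (lsuc 0ℓ ⊔ ℓ) where
  field
    attained : ∃[ X ] P X × Inverse κ ⟪ X ⟫
    least    : ∀ X → P X → κ ≲ ⟪ X ⟫

-- κ = ß_o
Isßₒ : Pred (Setoid 0ℓ 0ℓ) (lsuc 0ℓ)
Isßₒ = IsLeastCardinality OscillationFamily

-- κ = non(ℳ)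
IsNonℳ : Pred (Setoid 0ℓ 0ℓ) (lsuc 0ℓ)
IsNonℳ = IsLeastCardinality NonMeager

{-# OPTIONS --safe #-}
module Submission where

-- Every non-meager X is itself a family as required by ß_o: given a
-- conditionally convergent series a, the A for which the subseries does
-- not oscillate form a meager set.  Indeed such a subseries has partial
-- sums bounded above or below.  Those with sums at most k form a closed
-- set, and it contains no cylinder, since from any point on one may
-- take exactly the nonnegative terms, whose sum is infinite; similarly
-- for the negative terms.  Replacing a i by a rational within
-- δ i = 2^-(i+1) changes each partial sum by at most 1, so boundedness
-- can be discussed for rational series.

open import Defs
open import Axiom.ExcludedMiddle using (ExcludedMiddle)
open import Data.Product.Base using (∃-syntax; _×_)
open import Level using (0ℓ)

open import Algebra.Bundles using (CommutativeRing)
open import Data.Bool.Base using (true; false; if_then_else_)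
open import Data.Empty using (⊥)
open import Data.Integer.Base as ℤ using (+_)
import Data.Integer.Properties as ℤ
open import Data.Nat.Base as ℕ using (ℕ; zero; suc)
import Data.Nat.Properties as ℕ
open import Data.Product.Base using (_,_; proj₁; proj₂)
open import Data.Rational.Base as ℚ using (ℚ; 0ℚ; 1ℚ; ½; toℚᵘ)
import Data.Rational.Properties as ℚ
open import Data.Rational.Solver using (module +-*-Solver)
import Data.Rational.Unnormalised.Base as ℚᵘ
import Data.Rational.Unnormalised.Properties as ℚᵘ
open import Data.Sum.Base using (inj₁; inj₂; [_,_]′)
import Function.Construct.Composition as Composition
import Function.Construct.Identity as Identity
import Function.Properties.Inverse as Inverse
open import Relation.Binary.PropositionalEquality
  using (_≡_; refl; sym; trans; cong; cong₂; subst; subst₂)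
open import Relation.Nullary.Decidable using (yes; no; ⌊_⌋; decidable-stable)
open import Relation.Nullary.Negation using (¬_; contradiction)
open import Relation.Unary using (Pred; _∈_; _∉_; ⋃)

open import Algebra.Properties.Semiring.Mult
  (CommutativeRing.semiring ℚ.+-*-commutativeRing)
  using (×-assoc-*) renaming (_×_ to _·_)
open +-*-Solver using (solve; con; _:+_; _:*_; _:-_; :-_; _:=_)

-- Rational arithmetic

-- Turns linear arithmetic into ring solving: add up the hypotheses to
-- p ≤ q and check the identity s - r = q - p.
≤-by : ∀ {p q r s} → p ℚ.≤ q → s ℚ.- r ≡ q ℚ.- p → r ℚ.≤ s
≤-by {p} {q} {r} {s} p≤q eq = subst₂ ℚ._≤_
  (solve 2 (λ p r → p :+ (r :- p) := r) refl p r)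
  (trans (cong (λ d → d ℚ.+ (p ℚ.+ (r ℚ.- p))) (sym eq))
         (solve 3 (λ p r s → (s :- r) :+ (p :+ (r :- p)) := s) refl p r s))
  (subst (p ℚ.+ (r ℚ.- p) ℚ.≤_)
         (solve 3 (λ p q r → q :+ (r :- p) := (q :- p) :+ (p :+ (r :- p))) refl p q r)
         (ℚ.+-monoˡ-≤ (r ℚ.- p) p≤q))

0<½p : ∀ {p} → 0ℚ ℚ.< p → 0ℚ ℚ.< ½ ℚ.* p
0<½p {p} 0<p = subst (ℚ._< ½ ℚ.* p) (ℚ.*-zeroʳ ½) (ℚ.*-monoʳ-<-pos ½ 0<p)

½p+½p≡p : ∀ p → ½ ℚ.* p ℚ.+ ½ ℚ.* p ≡ p
½p+½p≡p = solve 1 (λ p → con ½ :* p :+ con ½ :* p := p) refl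

p≤∣p∣ : ∀ p → p ℚ.≤ ℚ.∣ p ∣
p≤∣p∣ p with ℚ.≤-total 0ℚ p
... | inj₁ 0≤p = ℚ.≤-reflexive (sym (ℚ.0≤p⇒∣p∣≡p 0≤p))
... | inj₂ p≤0 = ℚ.≤-trans p≤0 (ℚ.0≤∣p∣ p)

-p≤∣p∣ : ∀ p → ℚ.- p ℚ.≤ ℚ.∣ p ∣
-p≤∣p∣ p = subst (ℚ.- p ℚ.≤_) (ℚ.∣-p∣≡∣p∣ p) (p≤∣p∣ (ℚ.- p))

p≤0⇒∣p∣≡-p : ∀ {p} → p ℚ.≤ 0ℚ → ℚ.∣ p ∣ ≡ ℚ.- p
p≤0⇒∣p∣≡-p {p} p≤0 =
  trans (sym (ℚ.∣-p∣≡∣p∣ p)) (ℚ.0≤p⇒∣p∣≡p (ℚ.neg-antimono-≤ p≤0))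

∣-∣-comm : ∀ p q → ℚ.∣ p ℚ.- q ∣ ≡ ℚ.∣ q ℚ.- p ∣
∣-∣-comm p q = trans
  (cong ℚ.∣_∣ (solve 2 (λ p q → p :- q := :- (q :- p)) refl p q))
  (ℚ.∣-p∣≡∣p∣ (q ℚ.- p))

∣-∣-triangle : ∀ p q r → ℚ.∣ p ℚ.- r ∣ ℚ.≤ ℚ.∣ p ℚ.- q ∣ ℚ.+ ℚ.∣ q ℚ.- r ∣
∣-∣-triangle p q r = subst (λ d → ℚ.∣ d ∣ ℚ.≤ ℚ.∣ p ℚ.- q ∣ ℚ.+ ℚ.∣ q ℚ.- r ∣)
  (solve 3 (λ p q r → (p :- q) :+ (q :- r) := p :- r) refl p q r)
  (ℚ.∣p+q∣≤∣p∣+∣q∣ (p ℚ.- q) (q ℚ.- r))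

∣-∣-+ : ∀ p q r s → ℚ.∣ (p ℚ.+ q) ℚ.- (r ℚ.+ s) ∣ ℚ.≤ ℚ.∣ p ℚ.- r ∣ ℚ.+ ℚ.∣ q ℚ.- s ∣
∣-∣-+ p q r s = subst (λ d → ℚ.∣ d ∣ ℚ.≤ ℚ.∣ p ℚ.- r ∣ ℚ.+ ℚ.∣ q ℚ.- s ∣)
  (solve 4 (λ p q r s → (p :- r) :+ (q :- s) := (p :+ q) :- (r :+ s)) refl p q r s)
  (ℚ.∣p+q∣≤∣p∣+∣q∣ (p ℚ.- r) (q ℚ.- s))

-- `n · 1ℚ` is a repeated sum, normalised at every addition; in the unnormalised rationals it can be
-- compared with `n / 1` by cross-multiplication.
toℚᵘ-·1 : ∀ n → toℚᵘ (n · 1ℚ) ℚᵘ.≃ ℚᵘ.mkℚᵘ (+ n) 0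
toℚᵘ-·1 zero    = ℚᵘ.*≡* refl
toℚᵘ-·1 (suc n) = ℚᵘ.≃-trans (ℚ.toℚᵘ-homo-+ 1ℚ (n · 1ℚ))
  (ℚᵘ.≃-trans (ℚᵘ.+-congʳ ℚᵘ.1ℚᵘ (toℚᵘ-·1 n)) (ℚᵘ.*≡* numerators))
  where
  numerators : (+ 1 ℤ.+ + n ℤ.* + 1) ℤ.* + 1 ≡ + suc n ℤ.* + 1
  numerators = cong (λ i → (+ 1 ℤ.+ i) ℤ.* + 1) (ℤ.*-identityʳ (+ n))

≤-natural : ∀ p → ∃[ n ] p ℚ.≤ n · 1ℚ
≤-natural p@(ℚ.mkℚ num d _) = ℤ.∣ num ∣ , ℚ.toℚᵘ-cancel-≤
  (ℚᵘ.≤-respʳ-≃ (ℚᵘ.≃-sym (toℚᵘ-·1 ℤ.∣ num ∣)) (ℚᵘ.*≤* (i*1≤∣i∣*d num)))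
  where
  i*1≤∣i∣*d : ∀ i → i ℤ.* + 1 ℤ.≤ + ℤ.∣ i ∣ ℤ.* + suc d
  i*1≤∣i∣*d (+ n) = subst₂ ℤ._≤_ (ℤ.pos-* n 1) (ℤ.pos-* n (suc d))
    (ℤ.+≤+ (ℕ.*-monoʳ-≤ n (ℕ.s≤s ℕ.z≤n)))
  i*1≤∣i∣*d ℤ.-[1+ n ] = ℤ.≤-trans ℤ.-≤+ (ℤ.+≤+ ℕ.z≤n)

-- Bound `p / ε` by a natural number and multiply by `ε`.
archimedean : ∀ {ε} → 0ℚ ℚ.< ε → ∀ p → ∃[ n ] p ℚ.≤ n · ε
archimedean {ε} 0<ε p = let n , p/ε≤n = ≤-natural (p ℚ.* ε⁻¹) in
  n , subst₂ ℚ._≤_ p/ε*ε≡p (n·1*ε≡n·ε n) (ℚ.*-monoʳ-≤-nonNeg ε {{ℚ.pos⇒nonNeg ε}} p/ε≤n)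
  where
  instance
    ε-pos : ℚ.Positive ε
    ε-pos = ℚ.positive 0<ε

    ε-nonZero : ℚ.NonZero ε
    ε-nonZero = ℚ.pos⇒nonZero ε

  ε⁻¹ = ℚ.1/ ε

  p/ε*ε≡p : p ℚ.* ε⁻¹ ℚ.* ε ≡ p
  p/ε*ε≡p = trans (ℚ.*-assoc p ε⁻¹ ε)
    (trans (cong (p ℚ.*_) (ℚ.*-inverseˡ ε)) (ℚ.*-identityʳ p))

  n·1*ε≡n·ε : ∀ n → (n · 1ℚ) ℚ.* ε ≡ n · ε
  n·1*ε≡n·ε n = trans (×-assoc-* n 1ℚ ε) (cong (n ·_) (ℚ.*-identityˡ ε))

-- Sequences and series of rationals

BoundedAbove : (ℕ → ℚ) → Set
BoundedAbove u = ∃[ K ] (∀ n → u n ℚ.≤ K)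

-- Induction on `N`: the value at the last exceptional index is absorbed into the bound by a
-- maximum.
eventuallyBounded⇒bounded : ∀ {u : ℕ → ℚ} N K →
  (∀ n → N ℕ.≤ n → u n ℚ.≤ K) → BoundedAbove u
eventuallyBounded⇒bounded zero K h = K , λ n → h n ℕ.z≤n
eventuallyBounded⇒bounded {u} (suc N) K h =
  eventuallyBounded⇒bounded N (K ℚ.⊔ u N) bound
  where
  bound : ∀ n → N ℕ.≤ n → u n ℚ.≤ K ℚ.⊔ u N
  bound n N≤n with ℕ.m≤n⇒m<n∨m≡n N≤n
  ... | inj₁ N<n  = ℚ.≤-trans (h n N<n) (ℚ.p≤p⊔q K (u N))
  ... | inj₂ refl = ℚ.p≤q⊔p K (u N)

steps⇒mono : ∀ {u : ℕ → ℚ} {n} → (∀ m → n ℕ.≤ m → u m ℚ.≤ u (suc m)) →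
  ∀ {m} → n ℕ.≤ m → u n ℚ.≤ u m
steps⇒mono {u} {n} step n≤m = go (ℕ.≤⇒≤′ n≤m)
  where
  go : ∀ {m} → n ℕ.≤′ m → u n ℚ.≤ u m
  go (ℕ.≤′-reflexive refl) = ℚ.≤-refl
  go (ℕ.≤′-step n≤′m)      = ℚ.≤-trans (go n≤′m) (step _ (ℕ.≤′⇒≤ n≤′m))

Σ : (ℕ → ℚ) → ℕ → ℚ
Σ f zero    = 0ℚ
Σ f (suc n) = Σ f n ℚ.+ f n

Σ-cong : ∀ {f g : ℕ → ℚ} n → (∀ i → i ℕ.< n → f i ≡ g i) → Σ f n ≡ Σ g n
Σ-cong zero    f≡g = refl
Σ-cong (suc n) f≡g = cong₂ ℚ._+_
  (Σ-cong n λ i i<n → f≡g i (ℕ.m<n⇒m<1+n i<n)) (f≡g n ℕ.≤-refl)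

Σ-neg : ∀ f n → Σ (λ i → ℚ.- f i) n ≡ ℚ.- Σ f n
Σ-neg f zero    = refl
Σ-neg f (suc n) = trans (cong (ℚ._+ ℚ.- f n) (Σ-neg f n))
  (sym (ℚ.neg-distrib-+ (Σ f n) (f n)))

Σ-+ : ∀ f g n → Σ (λ i → f i ℚ.+ g i) n ≡ Σ f n ℚ.+ Σ g n
Σ-+ f g zero    = refl
Σ-+ f g (suc n) = trans (cong (ℚ._+ (f n ℚ.+ g n)) (Σ-+ f g n))
  (solve 4 (λ a b c d → (a :+ b) :+ (c :+ d) := (a :+ c) :+ (b :+ d)) refl
    (Σ f n) (Σ g n) (f n) (g n))

½^ : ℕ → ℚ
½^ zero    = 1ℚ
½^ (suc n) = ½ ℚ.* ½^ n

0<½^ : ∀ n → 0ℚ ℚ.< ½^ n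
0<½^ zero    = ℚ.positive⁻¹ 1ℚ
0<½^ (suc n) = 0<½p (0<½^ n)

δ : ℕ → ℚ
δ i = ½^ (suc i)

-- Carrying the remainder `½^ n` along makes the induction exact; `Σδ≤1` follows by dropping it.
Σδ+½^≡1 : ∀ n → Σ δ n ℚ.+ ½^ n ≡ 1ℚ
Σδ+½^≡1 zero    = refl
Σδ+½^≡1 (suc n) = trans
  (trans (ℚ.+-assoc (Σ δ n) (δ n) (δ n)) (cong (Σ δ n ℚ.+_) (½p+½p≡p (½^ n))))
  (Σδ+½^≡1 n)

Σδ≤1 : ∀ n → Σ δ n ℚ.≤ 1ℚ
Σδ≤1 n = ≤-by (ℚ.<⇒≤ (0<½^ n)) (trans (cong (ℚ._- Σ δ n) (sym (Σδ+½^≡1 n)))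
  (solve 2 (λ s p → (s :+ p) :- s := p :- con 0ℚ) refl (Σ δ n) (½^ n)))

-- Subsets of ℕ

restrict : 2^ℕ → (ℕ → ℚ) → ℕ → ℚ
restrict A b i = if A i then b i else 0ℚ

restrict-neg : ∀ A b i → restrict A (λ j → ℚ.- b j) i ≡ ℚ.- restrict A b i
restrict-neg A b i with A i
... | true  = refl
... | false = refl

-- Natural numbers as bounds keep the family countable, and by `boundedSums⇒SumsBelow` they lose
-- nothing.
SumsBelow : (ℕ → ℚ) → ℕ → Pred 2^ℕ 0ℓ
SumsBelow b k A = ∀ m → Σ (restrict A b) m ℚ.≤ k · 1ℚ

boundedSums⇒SumsBelow : ∀ {b A} → BoundedAbove (Σ (restrict A b)) →
  ∃[ k ] A ∈ SumsBelow b k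
boundedSums⇒SumsBelow (K , h) = let k , K≤k = ≤-natural K in
  k , λ m → ℚ.≤-trans (h m) K≤k

-- The sum up to `m` depends only on `A` below `m`, so a member of the set that agrees with `A`
-- there gives the bound.
SumsBelow-closed : ∀ {b k A} → A ∈ Closure (SumsBelow b k) → A ∈ SumsBelow b k
SumsBelow-closed {b} {k} A∈cl m = let B , A≈B , B∈ = A∈cl m in
  subst (ℚ._≤ k · 1ℚ)
    (sym (Σ-cong m λ i i<m → cong (if_then b i else 0ℚ) (A≈B i i<m))) (B∈ m)

-- Since ∣ b ∣ = 2 b⁺ - b, a bound on the sums of the positive terms
-- would bound the sums of ∣ b ∣.
SumsBelow-nowhereDense : ∀ {b} →
  BoundedAbove (λ n → ℚ.- Σ b n) → ¬ BoundedAbove (Σ (λ i → ℚ.∣ b i ∣)) →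
  ∀ k → NowhereDense (SumsBelow b k)
SumsBelow-nowhereDense {b} (K , -Σb≤K) unbounded k x (n , x≈⊆cl) =
  unbounded (eventuallyBounded⇒bounded n K′ bound)
  where
  -- `y` stays in the cylinder of `x` and beyond `n` picks out exactly the nonnegative terms.
  y : 2^ℕ
  y i = if ⌊ i ℕ.<? n ⌋ then x i else ⌊ 0ℚ ℚ.≤? b i ⌋

  x≈y : x ≈[ n ] y
  x≈y i i<n with i ℕ.<? n
  ... | yes _  = refl
  ... | no i≮n = contradiction i<n i≮n

  r : ℕ → ℚ
  r = restrict y b

  Σr≤k : ∀ m → Σ r m ℚ.≤ k · 1ℚ
  Σr≤k = SumsBelow-closed {k = k} (x≈⊆cl y x≈y)

  ∣b∣+b≡2r : ∀ i → n ℕ.≤ i → ℚ.∣ b i ∣ ℚ.+ b i ≡ r i ℚ.+ r i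
  ∣b∣+b≡2r i n≤i with i ℕ.<? n
  ... | yes i<n = contradiction n≤i (ℕ.<⇒≱ i<n)
  ... | no _ with 0ℚ ℚ.≤? b i
  ... | yes 0≤b = cong (ℚ._+ b i) (ℚ.0≤p⇒∣p∣≡p 0≤b)
  ... | no 0≰b  = trans
    (cong (ℚ._+ b i) (p≤0⇒∣p∣≡-p (ℚ.<⇒≤ (ℚ.≰⇒> 0≰b)))) (ℚ.+-inverseˡ (b i))

  -- `w` does not change from `n` on, where `∣b∣ + b = 2r`; its value at `n` accounts for the
  -- initial terms, whose choice is prescribed by `x`.
  w : ℕ → ℚ
  w m = (Σ r m ℚ.+ Σ r m) ℚ.- (Σ (λ i → ℚ.∣ b i ∣) m ℚ.+ Σ b m)

  w-step : ∀ m → n ℕ.≤ m → w m ℚ.≤ w (suc m)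
  w-step m n≤m = ℚ.≤-reflexive (trans
    (solve 4 (λ s t d e → (s :+ s) :- (t :+ d) :=
                          ((s :+ s) :- (t :+ d)) :+ (e :- e)) refl
      (Σ r m) (Σ (λ i → ℚ.∣ b i ∣) m) (Σ b m) (r m ℚ.+ r m))
    (trans (cong (λ e → w m ℚ.+ ((r m ℚ.+ r m) ℚ.- e)) (sym (∣b∣+b≡2r m n≤m)))
    (solve 6 (λ s t d u v e → ((s :+ s) :- (t :+ d)) :+ ((u :+ u) :- (v :+ e)) :=
               ((s :+ u) :+ (s :+ u)) :- ((t :+ v) :+ (d :+ e))) refl
      (Σ r m) (Σ (λ i → ℚ.∣ b i ∣) m) (Σ b m) (r m) ℚ.∣ b m ∣ (b m))))

  -- Solving `w n ≤ w m` for the sum of `∣ b ∣` bounds it by twice the sum of `r`, minus the sum of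
  -- `b`, minus `w n`.
  K′ : ℚ
  K′ = ((k · 1ℚ ℚ.+ k · 1ℚ) ℚ.+ K) ℚ.- w n

  bound : ∀ m → n ℕ.≤ m → Σ (λ i → ℚ.∣ b i ∣) m ℚ.≤ K′
  bound m n≤m = ≤-by
    (ℚ.+-mono-≤ (ℚ.+-mono-≤ (ℚ.+-mono-≤ (Σr≤k m) (Σr≤k m)) (-Σb≤K m))
                (steps⇒mono {w} w-step n≤m))
    (solve 6 (λ s t d k K w → (((k :+ k) :+ K) :- w) :- t :=
        (((k :+ k) :+ K) :+ ((s :+ s) :- (t :+ d))) :-
        (((s :+ s) :+ (:- d)) :+ w)) refl
      (Σ r m) (Σ (λ i → ℚ.∣ b i ∣) m) (Σ b m) (k · 1ℚ) K (w n))

-- Were there no index after which `u` rises by at most `ε`, it could climb by `ε` arbitrarily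
-- often, and the Archimedean property would contradict the bound.
bounded⇒Cauchy : ExcludedMiddle 0ℓ → ∀ {u : ℕ → ℚ} →
  (∀ n → u n ℚ.≤ u (suc n)) → BoundedAbove u →
  ∀ ε → 0ℚ ℚ.< ε → ∃[ N ] (∀ m n → N ℕ.≤ m → m ℕ.≤ n → u n ℚ.- u m ℚ.≤ ε)
bounded⇒Cauchy em {u} step (K , u≤K) ε 0<ε = let N , h = flat in
  N , λ m n N≤m m≤n → ≤-by
    (ℚ.+-mono-≤ (h n (ℕ.≤-trans N≤m m≤n)) (steps⇒mono {u} (λ i _ → step i) N≤m))
    (solve 4 (λ a b c e → e :- (c :- b) := ((a :+ e) :+ b) :- (c :+ a)) refl
      (u N) (u m) (u n) ε)
  where
  Flat : Set
  Flat = ∃[ N ] (∀ n → N ℕ.≤ n → u n ℚ.≤ u N ℚ.+ ε)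

  module _ (¬flat : ¬ Flat) where
    jump : ∀ N → ∃[ n ] u N ℚ.+ ε ℚ.≤ u n
    jump N = decidable-stable em λ ¬jump → ¬flat (N , λ n _ →
      ℚ.<⇒≤ (ℚ.≰⇒> λ uN+ε≤un → ¬jump (n , uN+ε≤un)))

    climb : ∀ j → ∃[ n ] u 0 ℚ.+ j · ε ℚ.≤ u n
    climb zero    = 0 , ℚ.≤-reflexive (ℚ.+-identityʳ (u 0))
    climb (suc j) = let n , h = climb j; m , h′ = jump n in
      m , ≤-by (ℚ.+-mono-≤ h h′)
            (solve 5 (λ a je b e c → c :- (a :+ (e :+ je)) :=
                                     (b :+ c) :- ((a :+ je) :+ (b :+ e))) refl
              (u 0) (j · ε) (u n) ε (u m))

    absurd : ∃[ j ] K ℚ.- u 0 ℚ.≤ j · ε → ⊥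
    -- One climb beyond the `j` that reach `K` leaves `ε ≤ 0`.
    absurd (j , K-u₀≤jε) = let n , h = climb (suc j) in
      ℚ.<-irrefl refl (ℚ.<-≤-trans 0<ε (≤-by (ℚ.+-mono-≤ (ℚ.+-mono-≤ h (u≤K n)) K-u₀≤jε)
        (solve 5 (λ a je b e K → con 0ℚ :- e :=
            ((b :+ K) :+ je) :- (((a :+ (e :+ je)) :+ b) :+ (K :- a))) refl
          (u 0) (j · ε) (u n) ε K)))

  flat : Flat
  flat = decidable-stable em λ ¬flat → absurd ¬flat (archimedean 0<ε (K ℚ.- u 0))

-- `δ n` is the difference of consecutive terms of the bounded monotone sequence `Σ δ`.
δ→0 : ExcludedMiddle 0ℓ →
  ∀ ε → 0ℚ ℚ.< ε → ∃[ N ] (∀ n → N ℕ.≤ n → δ n ℚ.≤ ε)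
δ→0 em ε 0<ε = let N , h = bounded⇒Cauchy em step (1ℚ , Σδ≤1) ε 0<ε in
  N , λ n N≤n → ≤-by (h n (suc n) N≤n (ℕ.n≤1+n n))
    (solve 3 (λ s d e → e :- d := e :- ((s :+ d) :- s)) refl (Σ δ n) (δ n) ε)
  where
  step : ∀ n → Σ δ n ℚ.≤ Σ δ (suc n)
  step n = ≤-by (ℚ.<⇒≤ (0<½^ (suc n)))
    (solve 2 (λ s d → (s :+ d) :- s := d :- con 0ℚ) refl (Σ δ n) (δ n))

-- Distances between reals

-- Slightly stronger than ∣ x - y ∣ ≤ ε, and dependent on the representatives.
Close : ℚ → ℝ → ℝ → Set
Close ε x y = ∃[ N ] (∀ k → N ℕ.≤ k → ℚ.∣ approx x k ℚ.- approx y k ∣ ℚ.≤ ε)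

Close-refl : ∀ x → Close 0ℚ x x
Close-refl x = 0 , λ k _ → ℚ.≤-reflexive (cong ℚ.∣_∣ (ℚ.+-inverseʳ (approx x k)))

Close-sym : ∀ {ε x y} → Close ε x y → Close ε y x
Close-sym {ε} {x} {y} (N , h) = N , λ k N≤k →
  subst (ℚ._≤ ε) (∣-∣-comm (approx x k) (approx y k)) (h k N≤k)

Close-mono : ∀ {ε ε′ x y} → ε ℚ.≤ ε′ → Close ε x y → Close ε′ x y
Close-mono ε≤ε′ (N , h) = N , λ k N≤k → ℚ.≤-trans (h k N≤k) ε≤ε′

Close-trans : ∀ {ε ε′ x y z} → Close ε x y → Close ε′ y z → Close (ε ℚ.+ ε′) x z
Close-trans {x = x} {y} {z} (M , h) (N , h′) = M ℕ.⊔ N , λ k M⊔N≤k → ℚ.≤-trans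
  (∣-∣-triangle (approx x k) (approx y k) (approx z k))
  (ℚ.+-mono-≤ (h k (ℕ.m⊔n≤o⇒m≤o M N M⊔N≤k)) (h′ k (ℕ.m⊔n≤o⇒n≤o M N M⊔N≤k)))

Close-+ : ∀ {ε ε′ x y x′ y′} → Close ε x y → Close ε′ x′ y′ →
  Close (ε ℚ.+ ε′) (x + x′) (y + y′)
Close-+ {x = x} {y} {x′} {y′} (M , h) (N , h′) = M ℕ.⊔ N , λ k M⊔N≤k → ℚ.≤-trans
  (∣-∣-+ (approx x k) (approx x′ k) (approx y k) (approx y′ k))
  (ℚ.+-mono-≤ (h k (ℕ.m⊔n≤o⇒m≤o M N M⊔N≤k)) (h′ k (ℕ.m⊔n≤o⇒n≤o M N M⊔N≤k)))

Close-nonNeg : ∀ {ε x y} → Close ε x y → 0ℚ ℚ.≤ ε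
Close-nonNeg {x = x} {y} (N , h) =
  ℚ.≤-trans (ℚ.0≤∣p∣ (approx x N ℚ.- approx y N)) (h N ℕ.≤-refl)

Close-fromℚ : ∀ {ε p q} → Close ε (fromℚ p) (fromℚ q) → ℚ.∣ p ℚ.- q ∣ ℚ.≤ ε
Close-fromℚ (N , h) = h N ℕ.≤-refl

Close-∣∣-0 : ∀ {ε x q} → Close ε x (fromℚ q) → Close (ℚ.∣ q ∣ ℚ.+ ε) ∣ x ∣ 0ℝ
Close-∣∣-0 {ε} {x} {q} (N , h) = N , λ k N≤k →
  subst (ℚ._≤ ℚ.∣ q ∣ ℚ.+ ε)
    (sym (trans (cong ℚ.∣_∣ (ℚ.+-identityʳ ℚ.∣ approx x k ∣)) (ℚ.∣∣p∣∣≡∣p∣ (approx x k))))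
    (ℚ.≤-trans
      (subst (λ p → ℚ.∣ p ∣ ℚ.≤ ℚ.∣ q ∣ ℚ.+ ℚ.∣ approx x k ℚ.- q ∣)
        (solve 2 (λ q p → q :+ (p :- q) := p) refl q (approx x k))
        (ℚ.∣p+q∣≤∣p∣+∣q∣ q (approx x k ℚ.- q)))
      (ℚ.+-monoʳ-≤ ℚ.∣ q ∣ (h k N≤k)))

rationalApprox : ∀ x ε → 0ℚ ℚ.< ε → ∃[ q ] Close ε x (fromℚ q)
rationalApprox x ε 0<ε = let N , h = isCauchy x ε 0<ε in
  approx x N , N , λ k N≤k → h k N N≤k ℕ.≤-refl

-- Strict inequality between reals needs a rational margin: half of the eventual lower bound `ε₀` of
-- `ε` bounds the distance, the other half is the margin.
⟶-intro : ∀ {s L} →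
  (∀ ε → 0ℚ ℚ.< ε → ∃[ N ] (∀ n → N ℕ.≤ n → Close ε (s n) L)) → s ⟶ L
⟶-intro h ε (ε₀ , 0<ε₀ , M , ε₀≤ε) = let N , close = h (½ ℚ.* ε₀) (0<½p 0<ε₀) in
  N , λ n N≤n → let K , d≤ = close n N≤n in
  ½ ℚ.* ε₀ , 0<½p 0<ε₀ , M ℕ.⊔ K , λ k M⊔K≤k → ℚ.≤-trans
    (ℚ.+-monoˡ-≤ (½ ℚ.* ε₀) (d≤ k (ℕ.m⊔n≤o⇒n≤o M K M⊔K≤k)))
    (subst (ℚ._≤ approx ε k)
      (trans (ℚ.+-identityˡ ε₀) (sym (½p+½p≡p ε₀)))
      (ε₀≤ε k (ℕ.m⊔n≤o⇒m≤o M K M⊔K≤k)))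

⟶-elim : ∀ {s L} → s ⟶ L →
  ∀ ε → 0ℚ ℚ.< ε → ∃[ N ] (∀ n → N ℕ.≤ n → Close ε (s n) L)
⟶-elim {s} {L} s⟶L ε 0<ε =
  let N , h = s⟶L (fromℚ ε) (ε , 0<ε , 0 , λ _ _ → ℚ.≤-reflexive (ℚ.+-identityˡ ε)) in
  N , λ n N≤n → let ε₀ , 0<ε₀ , M , d = h n N≤n in
  M , λ k M≤k → ℚ.≤-trans
    (≤-by (ℚ.<⇒≤ 0<ε₀) (solve 2 (λ d e → (d :+ e) :- d := e :- con 0ℚ) refl
      ℚ.∣ approx (s n) k ℚ.- approx L k ∣ ε₀))
    (d k M≤k)

-- Completeness of the reals

module _ (em : ExcludedMiddle 0ℓ) {s : ℕ → ℝ}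
  (s-cauchy : ∀ ε → 0ℚ ℚ.< ε →
    ∃[ N ] (∀ m n → N ℕ.≤ m → m ℕ.≤ n → Close ε (s n) (s m)))
  where

  -- Diagonal argument: the rationals `q` approximating the terms of `s` are themselves Cauchy,
  -- hence represent a real, and this real is the limit.
  approximations⇒Converges : ∀ {q : ℕ → ℚ} →
    (∀ n → Close (δ n) (s n) (fromℚ (q n))) → Converges s
  approximations⇒Converges {q} s-close-q = L , ⟶-intro {s} {L} s⟶L
    where
    q-near : ∀ {ε θ m n} → Close ε (s n) (s m) → δ m ℚ.≤ θ → δ n ℚ.≤ θ →
      ℚ.∣ q m ℚ.- q n ∣ ℚ.≤ (θ ℚ.+ ε) ℚ.+ θ
    q-near {m = m} {n} close δm≤θ δn≤θ = Close-fromℚ {p = q m} {q n}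
      (Close-trans {x = fromℚ (q m)} {s n} {fromℚ (q n)}
        (Close-trans {x = fromℚ (q m)} {s m} {s n}
          (Close-sym {x = s m} {fromℚ (q m)}
            (Close-mono {x = s m} {fromℚ (q m)} δm≤θ (s-close-q m)))
          (Close-sym {x = s n} {s m} close))
        (Close-mono {x = s n} {fromℚ (q n)} δn≤θ (s-close-q n)))

    θ+η+θ≡2η : ∀ θ η → θ ℚ.+ θ ≡ η → (θ ℚ.+ η) ℚ.+ θ ≡ η ℚ.+ η
    θ+η+θ≡2η θ η refl = solve 1
      (λ t → (t :+ (t :+ t)) :+ t := (t :+ t) :+ (t :+ t)) refl θ

    q-cauchy : IsCauchy q
    q-cauchy ε 0<ε = M ℕ.⊔ N , λ m n m≥ n≥ →
      let δm≤θ = δ≤θ m (ℕ.m⊔n≤o⇒m≤o M N m≥)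
          δn≤θ = δ≤θ n (ℕ.m⊔n≤o⇒m≤o M N n≥)
          N≤m  = ℕ.m⊔n≤o⇒n≤o M N m≥
          N≤n  = ℕ.m⊔n≤o⇒n≤o M N n≥
      in subst (ℚ.∣ q m ℚ.- q n ∣ ℚ.≤_)
        (trans (θ+η+θ≡2η θ η (½p+½p≡p η)) (½p+½p≡p ε))
        ([ (λ m≤n → q-near (close m n N≤m m≤n) δm≤θ δn≤θ)
         , (λ n≤m → subst (ℚ._≤ (θ ℚ.+ η) ℚ.+ θ) (∣-∣-comm (q n) (q m))
                      (q-near (close n m N≤n n≤m) δn≤θ δm≤θ))
         ]′ (ℕ.≤-total m n))
      where
      -- The triangle inequality passes from `q m` through `s m` and `s n` to `q n`, costing
      -- `θ + η + θ = ε`.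
      η = ½ ℚ.* ε
      θ = ½ ℚ.* η
      small = δ→0 em θ (0<½p (0<½p 0<ε))
      M = proj₁ small
      δ≤θ = proj₂ small
      tail = s-cauchy η (0<½p 0<ε)
      N = proj₁ tail
      close = proj₂ tail

    L : ℝ
    L = mkℝ q q-cauchy

    s⟶L : ∀ ε → 0ℚ ℚ.< ε → ∃[ N ] (∀ n → N ℕ.≤ n → Close ε (s n) L)
    s⟶L ε 0<ε = M ℕ.⊔ N , λ n n≥ → subst (λ ε → Close ε (s n) L) (½p+½p≡p ε)
      (Close-trans {x = s n} {fromℚ (q n)} {L}
        (Close-mono {x = s n} {fromℚ (q n)} (δ≤η n (ℕ.m⊔n≤o⇒m≤o M N n≥)) (s-close-q n))
        -- The `k`-th approximation of `L` is `q k`, so this is the Cauchy property of `q`.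
        (N , λ k N≤k → near n k (ℕ.m⊔n≤o⇒n≤o M N n≥) N≤k))
      where
      η = ½ ℚ.* ε
      small = δ→0 em η (0<½p 0<ε)
      M = proj₁ small
      δ≤η = proj₂ small
      tail = q-cauchy η (0<½p 0<ε)
      N = proj₁ tail
      near = proj₂ tail

  Cauchy⇒Converges : Converges s
  Cauchy⇒Converges = approximations⇒Converges
    λ n → proj₂ (rationalApprox (s n) (δ n) (0<½^ (suc n)))

-- Series of reals

-- Closeness to `0ℝ` expresses `∣ c i ∣ ≤ e i`. A block of terms of `c` is then bounded by the same
-- block of `e`, and the sums of `e` are Cauchy.
comparisonTest : ExcludedMiddle 0ℓ → ∀ {c : ℕ → ℝ} {e : ℕ → ℚ} →
  (∀ i → Close (e i) (c i) 0ℝ) → BoundedAbove (Σ e) → Converges (partialSum c)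
comparisonTest em {c} {e} c≤e bounded = Cauchy⇒Converges em {partialSum c} λ ε 0<ε →
  let N , h = bounded⇒Cauchy em step bounded ε 0<ε in
  N , λ m n N≤m m≤n → Close-mono {x = partialSum c n} {partialSum c m}
    (h m n N≤m m≤n) (tail (ℕ.≤⇒≤′ m≤n))
  where
  step : ∀ n → Σ e n ℚ.≤ Σ e (suc n)
  step n = ≤-by (Close-nonNeg {x = c n} {0ℝ} (c≤e n))
    (solve 2 (λ s d → (s :+ d) :- s := d :- con 0ℚ) refl (Σ e n) (e n))

  tail : ∀ {m n} → m ℕ.≤′ n →
    Close (Σ e n ℚ.- Σ e m) (partialSum c n) (partialSum c m)
  tail {m} (ℕ.≤′-reflexive refl) =
    subst (λ ε → Close ε (partialSum c m) (partialSum c m))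
      (sym (ℚ.+-inverseʳ (Σ e m))) (Close-refl (partialSum c m))
  tail {m} (ℕ.≤′-step {n} m≤′n) =
    subst (λ ε → Close ε (partialSum c n + c n) (partialSum c m))
      (solve 3 (λ s t d → (s :- t) :+ d := (s :+ d) :- t) refl (Σ e n) (Σ e m) (e n))
      (proj₁ close , λ k N≤k → subst
        (λ p → ℚ.∣ approx (partialSum c n + c n) k ℚ.- p ∣ ℚ.≤ (Σ e n ℚ.- Σ e m) ℚ.+ e n)
        (ℚ.+-identityʳ (approx (partialSum c m) k)) (proj₂ close k N≤k))
    where
    close = Close-+ {x = partialSum c n} {partialSum c m} {c n} {0ℝ} (tail m≤′n) (c≤e n)

-- Boundedness and oscillation

module _ {s : ℕ → ℝ} {t : ℕ → ℚ} (s-close-t : ∀ n → Close 1ℚ (s n) (fromℚ (t n))) where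

  Converges⇒bounded : Converges s → BoundedAbove t × BoundedAbove (λ n → ℚ.- t n)
  Converges⇒bounded (L , s⟶L) =
    let q , L-close-q = rationalApprox L 1ℚ (ℚ.positive⁻¹ 1ℚ)
        N , h = ⟶-elim {s} {L} s⟶L 1ℚ (ℚ.positive⁻¹ 1ℚ)
        -- One unit each for passing from `t n` to `s n`, on to `L`, and on to `q`.
        3ℚ = 1ℚ ℚ.+ 1ℚ ℚ.+ 1ℚ
        t-near-q : ∀ n → N ℕ.≤ n → ℚ.∣ t n ℚ.- q ∣ ℚ.≤ 3ℚ
        t-near-q n N≤n = Close-fromℚ {p = t n} {q}
          (Close-trans {x = fromℚ (t n)} {L} {fromℚ q}
            (Close-trans {x = fromℚ (t n)} {s n} {L}
              (Close-sym {x = s n} {fromℚ (t n)} (s-close-t n)) (h n N≤n))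
            L-close-q)
    in eventuallyBounded⇒bounded N (q ℚ.+ 3ℚ) (λ n N≤n → ≤-by
         (ℚ.≤-trans (p≤∣p∣ (t n ℚ.- q)) (t-near-q n N≤n))
         (solve 3 (λ q t c → (q :+ c) :- t := c :- (t :- q)) refl q (t n) 3ℚ))
     , eventuallyBounded⇒bounded N (3ℚ ℚ.- q) (λ n N≤n → ≤-by
         (ℚ.≤-trans (-p≤∣p∣ (t n ℚ.- q)) (t-near-q n N≤n))
         (solve 3 (λ q t c → (c :- q) :- (:- t) := c :- (:- (t :- q))) refl q (t n) 3ℚ))

  -- Eventually `s n` is positive, and `t n` is within 1 of it, so eventually `t n ≥ -1`.
  ⟶+∞⇒bounded : s ⟶+∞ → BoundedAbove (λ n → ℚ.- t n)
  ⟶+∞⇒bounded s⟶+∞ = let N , h = s⟶+∞ 0ℝ in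
    eventuallyBounded⇒bounded N 1ℚ λ n N≤n →
      let ε , 0<ε , M , 0+ε≤s = h n N≤n
          M′ , near = s-close-t n
          k = M ℕ.⊔ M′
      in ≤-by
        (ℚ.+-mono-≤
          (ℚ.+-mono-≤ (0+ε≤s k (ℕ.m≤m⊔n M M′)) (ℚ.<⇒≤ 0<ε))
          (ℚ.≤-trans (p≤∣p∣ (approx (s n) k ℚ.- t n)) (near k (ℕ.m≤n⊔m M M′))))
        (solve 3 (λ s t e → con 1ℚ :- (:- t) :=
            ((s :+ e) :+ con 1ℚ) :- (((con 0ℚ :+ e) :+ con 0ℚ) :+ (s :- t))) refl
          (approx (s n) k) (t n) ε)

  ⟶-∞⇒bounded : s ⟶-∞ → BoundedAbove t
  ⟶-∞⇒bounded s⟶-∞ = let N , h = s⟶-∞ 0ℝ in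
    eventuallyBounded⇒bounded N 1ℚ λ n N≤n →
      let ε , 0<ε , M , s+ε≤0 = h n N≤n
          M′ , near = s-close-t n
          k = M ℕ.⊔ M′
      in ≤-by
        (ℚ.+-mono-≤
          (ℚ.+-mono-≤ (s+ε≤0 k (ℕ.m≤m⊔n M M′)) (ℚ.<⇒≤ 0<ε))
          (ℚ.≤-trans (-p≤∣p∣ (approx (s n) k ℚ.- t n)) (near k (ℕ.m≤n⊔m M M′))))
        (solve 3 (λ s t e → con 1ℚ :- t :=
            ((con 0ℚ :+ e) :+ con 1ℚ) :- (((s :+ e) :+ con 0ℚ) :+ (:- (s :- t)))) refl
          (approx (s n) k) (t n) ε)

  -- Convergence or divergence to `-∞` would bound `t` above, and divergence to `+∞` would bound it
  -- below.
  unbounded⇒Oscillates : ¬ BoundedAbove t → ¬ BoundedAbove (λ n → ℚ.- t n) →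
    Oscillates s
  unbounded⇒Oscillates ¬above ¬below =
      (λ conv → ¬above (proj₁ (Converges⇒bounded conv)))
    , (λ s⟶+∞ → ¬below (⟶+∞⇒bounded s⟶+∞))
    , (λ s⟶-∞ → ¬above (⟶-∞⇒bounded s⟶-∞))

-- One step of `subsum`. A skipped term adds no error, but its allowance `ε′ ≥ 0` is counted anyway,
-- which keeps the total independent of the subset.
Close-if : ∀ β {ε ε′ x y p q} → Close ε x (fromℚ p) → Close ε′ y (fromℚ q) →
  Close (ε ℚ.+ ε′) (if β then x + y else x) (fromℚ (p ℚ.+ (if β then q else 0ℚ)))
Close-if true {x = x} {y} {p} {q} x≈p y≈q =
  Close-+ {x = x} {fromℚ p} {y} {fromℚ q} x≈p y≈q
Close-if false {ε} {ε′} {x} {y} {p} {q} x≈p y≈q =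
  subst (λ r → Close (ε ℚ.+ ε′) x (fromℚ r)) (sym (ℚ.+-identityʳ p))
    (Close-mono {x = x} {fromℚ p}
      (≤-by (Close-nonNeg {x = y} {fromℚ q} y≈q)
        (solve 2 (λ e d → (e :+ d) :- e := d :- con 0ℚ) refl ε ε′))
      x≈p)

subsum-close : ∀ {a : ℕ → ℝ} {b : ℕ → ℚ} → (∀ i → Close (δ i) (a i) (fromℚ (b i))) →
  ∀ A n → Close 1ℚ (subsum A a n) (fromℚ (Σ (restrict A b) n))
subsum-close {a} {b} a-close-b A n =
  Close-mono {x = subsum A a n} {fromℚ (Σ (restrict A b) n)} (Σδ≤1 n) (go n)
  where
  go : ∀ n → Close (Σ δ n) (subsum A a n) (fromℚ (Σ (restrict A b) n))
  go zero    = Close-refl 0ℝ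
  go (suc n) = Close-if (A n) {x = subsum A a n} {a n} {Σ (restrict A b) n} {b n}
    (go n) (a-close-b n)

subsum-full : ∀ a n → subsum (λ _ → true) a n ≡ partialSum a n
subsum-full a zero    = refl
subsum-full a (suc n) = cong (_+ a n) (subsum-full a n)

-- Meager sets

-- The order is `f 0, g 0, f 1, g 1, …`; exchanging the two sequences at each step avoids parity.
interleave : {A : Set₁} → (ℕ → A) → (ℕ → A) → ℕ → A
interleave f g zero    = f 0
interleave f g (suc n) = interleave g (λ k → f (suc k)) n

interleave-all : ∀ {A : Set₁} (P : A → Set) {f g : ℕ → A} →
  (∀ k → P (f k)) → (∀ k → P (g k)) → ∀ n → P (interleave f g n)
interleave-all P Pf Pg zero    = Pf 0
interleave-all P Pf Pg (suc n) = interleave-all P Pg (λ k → Pf (suc k)) n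

-- The two claims are proved together because dropping the head of `interleave D E` exchanges the
-- roles of the sequences; `k` decreases with every second exchange.
⋃-interleaveˡ : ∀ {D E : ℕ → Pred 2^ℕ 0ℓ} {x} k → x ∈ D k → x ∈ ⋃ ℕ (interleave D E)
⋃-interleaveʳ : ∀ {D E : ℕ → Pred 2^ℕ 0ℓ} {x} k → x ∈ E k → x ∈ ⋃ ℕ (interleave D E)
⋃-interleaveˡ zero x∈ = 0 , x∈
⋃-interleaveˡ {D} {E} (suc k) x∈ =
  let n , h = ⋃-interleaveʳ {E} {λ k → D (suc k)} k x∈ in suc n , h
⋃-interleaveʳ {D} {E} k x∈ =
  let n , h = ⋃-interleaveˡ {E} {λ k → D (suc k)} k x∈ in suc n , h

-- Non-meager sets as oscillation families

NonMeager⇒OscillationFamily : ExcludedMiddle 0ℓ →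
  ∀ X → NonMeager X → OscillationFamily X
NonMeager⇒OscillationFamily em X nonMeager a (a-conv , ¬a-absConv) =
  -- If no member of `X` gave an oscillating subseries, every member would lie in some `D k`, and
  -- `X` would be meager.
  decidable-stable em λ ¬osc → nonMeager
    ( D
    , interleave-all NowhereDense
        (SumsBelow-nowhereDense -Σb-bounded Σ∣b∣-unbounded)
        (SumsBelow-nowhereDense -Σ-b-bounded Σ∣-b∣-unbounded)
    , λ {A} A∈X → decidable-stable em λ A∉⋃D →
        ¬osc (A , A∈X , avoiding⇒Oscillates A A∉⋃D))
  where
  b -b : ℕ → ℚ
  b i  = proj₁ (rationalApprox (a i) (δ i) (0<½^ (suc i)))
  -b i = ℚ.- b i

  a-close-b : ∀ i → Close (δ i) (a i) (fromℚ (b i))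
  a-close-b i = proj₂ (rationalApprox (a i) (δ i) (0<½^ (suc i)))

  D : ℕ → Pred 2^ℕ 0ℓ
  -- The sets for `-b` catch the subseries whose sums are bounded below.
  D = interleave (SumsBelow b) (SumsBelow -b)

  Σb-bounded : BoundedAbove (Σ b) × BoundedAbove (λ n → ℚ.- Σ b n)
  Σb-bounded = Converges⇒bounded {partialSum a}
    (λ n → subst (λ x → Close 1ℚ x (fromℚ (Σ b n))) (subsum-full a n)
                 (subsum-close a-close-b (λ _ → true) n))
    a-conv

  -Σb-bounded : BoundedAbove (λ n → ℚ.- Σ b n)
  -Σb-bounded = proj₂ Σb-bounded

  -Σ-b-bounded : BoundedAbove (λ n → ℚ.- Σ -b n)
  -Σ-b-bounded = let K , h = proj₁ Σb-bounded in K , λ n → subst (ℚ._≤ K)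
    (trans (solve 1 (λ p → p := :- (:- p)) refl (Σ b n)) (cong ℚ.-_ (sym (Σ-neg b n))))
    (h n)

  -- Since `∣ a i ∣ ≤ ∣ b i ∣ + δ i`, a bound for the sums of `∣ b ∣` would make `a` absolutely
  -- convergent.
  Σ∣b∣-unbounded : ¬ BoundedAbove (Σ (λ i → ℚ.∣ b i ∣))
  Σ∣b∣-unbounded (K , h) = ¬a-absConv
    (comparisonTest em (λ i → Close-∣∣-0 {x = a i} (a-close-b i))
      (K ℚ.+ 1ℚ , λ n → subst (ℚ._≤ K ℚ.+ 1ℚ) (sym (Σ-+ (λ i → ℚ.∣ b i ∣) δ n))
        (ℚ.+-mono-≤ (h n) (Σδ≤1 n))))

  Σ∣-b∣-unbounded : ¬ BoundedAbove (Σ (λ i → ℚ.∣ -b i ∣))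
  Σ∣-b∣-unbounded (K , h) = Σ∣b∣-unbounded
    (K , λ n → subst (ℚ._≤ K) (Σ-cong n (λ i _ → ℚ.∣-p∣≡∣p∣ (b i))) (h n))

  avoiding⇒Oscillates : ∀ A → A ∉ ⋃ ℕ D → Oscillates (subsum A a)
  avoiding⇒Oscillates A A∉⋃D = unbounded⇒Oscillates {subsum A a} (subsum-close a-close-b A)
    (λ above → let k , A∈ = boundedSums⇒SumsBelow {b} {A} above in
      A∉⋃D (⋃-interleaveˡ {SumsBelow b} {SumsBelow -b} k A∈))
    (λ (K , below) →
      let above = K , λ n → subst (ℚ._≤ K)
            (sym (trans (Σ-cong n (λ i _ → restrict-neg A b i)) (Σ-neg (restrict A b) n)))
            (below n)
          k , A∈ = boundedSums⇒SumsBelow { -b} {A} above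
      in A∉⋃D (⋃-interleaveʳ {SumsBelow b} {SumsBelow -b} k A∈))

theorem13 : ExcludedMiddle 0ℓ →
    (∀ ß 𝔫 → Isßₒ ß → IsNonℳ 𝔫 → ß ≲ 𝔫)
    × (∀ X → NonMeager X → ∃[ 𝒜 ] OscillationFamily 𝒜 × ⟪ 𝒜 ⟫ ≲ ⟪ X ⟫)
theorem13 em =
    -- A set `X` attaining `𝔫` is itself an oscillation family, so `ß` injects into it by leastness.
    (λ ß 𝔫 isß is𝔫 →
      let X , nonMeager , 𝔫≅X = IsLeastCardinality.attained is𝔫 in
      Composition.injection
        (IsLeastCardinality.least isß X (NonMeager⇒OscillationFamily em X nonMeager))
        (Inverse.Inverse⇒Injection (Inverse.sym 𝔫≅X)))
  , (λ X nonMeager →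
      X , NonMeager⇒OscillationFamily em X nonMeager , Identity.injection ⟪ X ⟫)
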